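{- For every $n\ge2$, $$|\mathcal{B}_n(321)|=C(n)-C(n-1)=\frac{3}{n+1}\binom{2n-2}{n-2},$$ where $C(m)=\frac{1}{m+1}\binom{2m}{m}$ is the $m$-th Catalan number.
   Context: A ballot permutation is a $\pi\in\mathfrak{S}_n$ such that every prefix $\pi_1\cdots\pi_i$ has at most as many descents ($\pi_j>\pi_{j+1}$) as ascents ($\pi_j<\pi_{j+1}$); $\mathcal{B}_n$ denotes the set of them. A permutation avoids the pattern $\sigma\in\mathfrak{S}_k$ if it has no subsequence order-isomorphic to $\sigma$; $\mathcal{B}_n(\sigma)$ is the set of $\sigma$-avoiding elements of $\mathcal{B}_n$. -}

module Defs where

open import Data.Bool.Base using (if_then_else_)
open import Data.Fin.Base using (Fin; _<_)
open import Data.Fin.Permutation using (Permutation′; _⟨$⟩ʳ_; _≈_; reverse)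
open import Data.Fin.Properties using (_<?_)
open import Data.Integer.Base using (+_)
open import Data.List.Base using (List; []; _∷_; tabulate; take)
open import Data.Nat.Base as ℕ using (ℕ; zero; suc; _≤_)
import Data.Nat.Combinatorics as Comb
open import Data.Product.Base using (Σ-syntax; _×_; proj₁)
open import Data.Rational.Base as ℚ using (ℚ)
open import Function.Bundles using (Inverse; _⇔_)
open import Level using (0ℓ)
open import Relation.Binary.Bundles using (Setoid)
open import Relation.Binary.Core using (_Preserves_⟶_)
open import Relation.Binary.PropositionalEquality using (refl; sym; trans; setoid)
open import Relation.Nullary using (¬_; does)

-- The one-line notation π₁ ⋯ πₙ, with letters 0, …, n-1 instead of 1, …, n.
word : ∀ {n} → Permutation′ n → List (Fin n)
word π = tabulate (π ⟨$⟩ʳ_)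

ascents : ∀ {n} → List (Fin n) → ℕ
ascents []           = 0
ascents (x ∷ [])     = 0
ascents (x ∷ y ∷ zs) =
  if does (x <? y) then suc (ascents (y ∷ zs)) else ascents (y ∷ zs)

descents : ∀ {n} → List (Fin n) → ℕ
descents []           = 0
descents (x ∷ [])     = 0
descents (x ∷ y ∷ zs) =
  if does (y <? x) then suc (descents (y ∷ zs)) else descents (y ∷ zs)

-- For i > n, take i is the whole word, so quantifying over all i
-- adds nothing to quantifying over the prefixes.
Ballot : ∀ {n} → Permutation′ n → Set
Ballot π = ∀ i → descents (take i (word π)) ≤ ascents (take i (word π))

-- f lists the positions of the subsequence of π order-isomorphic to σ.
Contains : ∀ {k n} → Permutation′ k → Permutation′ n → Set
Contains {k} {n} σ π =
  Σ[ f ∈ (Fin k → Fin n) ]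
    f Preserves _<_ ⟶ _<_ ×
    (∀ a b → (σ ⟨$⟩ʳ a < σ ⟨$⟩ʳ b) ⇔ (π ⟨$⟩ʳ f a < π ⟨$⟩ʳ f b))

Avoids : ∀ {k n} → Permutation′ k → Permutation′ n → Set
Avoids σ π = ¬ Contains σ π

-- The elements of 𝓑ₙ(σ).  Two of them are equal when the underlying
-- permutations agree pointwise; the proofs they carry are ignored.
𝓑 : ∀ {k} → ℕ → Permutation′ k → Setoid 0ℓ 0ℓ
𝓑 n σ = record
  { Carrier       = Σ[ π ∈ Permutation′ n ] Ballot π × Avoids σ π
  ; _≈_           = λ p q → proj₁ p ≈ proj₁ q
  ; isEquivalence = record
    { refl  = λ _ → refl
    ; sym   = λ p≈q i → sym (p≈q i)
    ; trans = λ p≈q q≈r i → trans (p≈q i) (q≈r i)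
    }
  }

HasCardinality : Setoid 0ℓ 0ℓ → ℕ → Set
HasCardinality S c = Inverse S (setoid (Fin c))

-- The pattern 321: reverse sends position i to 2 - i.
pattern321 : Permutation′ 3
pattern321 = reverse

fromℕ : ℕ → ℚ
fromℕ m = + m ℚ./ 1

binomial : ℕ → ℕ → ℚ
binomial n k = fromℕ (n Comb.C k)

-- Rational-valued, so that neither the division here nor a difference
-- of two values is truncated.
catalan : ℕ → ℚ
catalan m = (+ 1 ℚ./ suc m) ℚ.* binomial (2 ℕ.* m) m

{-# OPTIONS --safe #-}
module Submission where

-- A 321-avoiding permutation has no two consecutive descents, so it is ballot
-- exactly when its first step is an ascent.  Putting a letter j in front of a
-- 321-avoiding word (and shifting up the letters ≥ j) creates no 321 exactly when
-- the letters below j appear in increasing order.  Let l be the largest number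
-- for which the letters below l do; then j ranges over 0, …, l, and the new value
-- of l is l + 1 for j = 0 and j otherwise.  This is the Catalan generating tree,
-- whose k-generation descendant counts are the ballot numbers.  The first step is
-- an ascent when the last inserted letter does not exceed the one inserted before
-- it, so only the last two generations need to be counted differently.

open import Defs
open import Data.Empty using (⊥-elim)
open import Data.Fin.Base
  using (Fin; zero; suc; toℕ; fromℕ<; inject₁; inject≤; punchIn; _<_)
open import Data.Fin.Patterns using (0F; 1F; 2F)
open import Data.Fin.Permutation
  using (Permutation′; _⟨$⟩ʳ_; _⟨$⟩ˡ_; _≈_; id; inverseʳ; insert; remove; insert-punchIn; punchIn-permute)
import Data.Fin.Properties as Fin
open import Data.Fin.Properties
  using (_<?_; toℕ<n; toℕ-injective; toℕ-fromℕ; toℕ-inject₁; toℕ-inject≤; toℕ-fromℕ<;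
         punchIn-mono-≤; punchIn-cancel-≤; punchIn-injective; +↔⊎)
open import Data.List.Base using (_∷_; take; tabulate)
open import Data.Nat.Base as ℕ using (ℕ; zero; suc; _≤_; z≤n; s≤s)
import Data.Nat.Properties as ℕ
open import Data.Product.Base using (Σ; Σ-syntax; ∃-syntax; _×_; _,_; proj₁; proj₂)
open import Data.Product.Function.Dependent.Propositional using (congˡ)
open import Data.Sum.Base using (_⊎_; inj₁; inj₂; [_,_]′)
open import Data.Sum.Function.Propositional using (_⊎-↔_)
open import Data.Unit.Base using (⊤; tt)
open import Function.Base using (_∘_)
open import Function.Bundles using (Inverse; Injection; Equivalence; _↔_; mk⇔; mk↔ₛ′)
open import Function.Construct.Composition using (_↔-∘_; inverse)
open import Function.Construct.Identity using (↔-id)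
open import Function.Construct.Symmetry using (↔-sym)
open import Function.Properties.Inverse using (↔⇒↣)
open import Function.Related.TypeIsomorphisms using (Σ-assoc)
open import Relation.Binary.Bundles using (Setoid)
open import Relation.Binary.PropositionalEquality
open import Relation.Nullary using (¬_; yes; no; contradiction)
open import Relation.Nullary.Decidable using (dec-true; dec-false)

private
  variable
    k m n : ℕ

-- 321-avoidance and isolated descents

Avoids321 : (Fin n → Fin m) → Set
Avoids321 f = ∀ {a b c} → a < b → b < c → f b < f a → ¬ f c < f b

-- Encodes that the letters below `k` appear in increasing order: for distinct letters this fails
-- exactly when some inversion has its larger letter below `k`, so bounding the larger letter
-- suffices.
NoInversionBelow : ℕ → (Fin n → Fin m) → Set
NoInversionBelow k f = ∀ {a b} → a < b → f b < f a → k ≤ toℕ (f a)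

noInversionBelow-resp : {f g : Fin n → Fin m} → f ≗ g → NoInversionBelow k f → NoInversionBelow k g
noInversionBelow-resp {k = k} f≗g ni {a} {b} a<b p =
  subst (λ x → k ≤ toℕ x) (f≗g a) (ni a<b (subst₂ _<_ (sym (f≗g b)) (sym (f≗g a)) p))

-- What `Avoids321` becomes for distinct letters. The strict conclusion spares the induction along
-- `f ∘ suc` from carrying injectivity.
DescentsIsolated : (Fin n → Fin m) → Set
DescentsIsolated f = ∀ {a b c} → a < b → b < c → f b < f a → f b < f c

descentsIsolated-tail : (f : Fin (suc n) → Fin m) → DescentsIsolated f → DescentsIsolated (f ∘ suc)
descentsIsolated-tail f iso a<b b<c = iso (s≤s a<b) (s≤s b<c)

≮∧≢⇒> : (π : Permutation′ n) → ∀ {a b} → ¬ π ⟨$⟩ʳ a < π ⟨$⟩ʳ b → b ≢ a → π ⟨$⟩ʳ b < π ⟨$⟩ʳ a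
≮∧≢⇒> π ≮ b≢a = Fin.≤∧≢⇒< (ℕ.≮⇒≥ ≮) (b≢a ∘ Injection.injective (↔⇒↣ π))

avoids⇒avoids321 : (π : Permutation′ n) → Avoids pattern321 π → Avoids321 (π ⟨$⟩ʳ_)
avoids⇒avoids321 {n} π av {a} {b} {c} a<b b<c πb<πa πc<πb = av (pos , mono , iso)
  where
  pos : Fin 3 → Fin n
  pos 0F = a
  pos 1F = b
  pos 2F = c

  mono : ∀ {i j} → i < j → pos i < pos j
  mono {0F} {1F} _ = a<b
  mono {0F} {2F} _ = ℕ.<-trans a<b b<c
  mono {1F} {2F} _ = b<c
  mono {0F} {0F} ()
  mono {1F} {0F} ()
  mono {1F} {1F} (s≤s ())
  mono {2F} {0F} ()
  mono {2F} {1F} (s≤s ())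
  mono {2F} {2F} (s≤s (s≤s ()))

  iso : ∀ i j → _
  iso 0F 0F = mk⇔ (⊥-elim ∘ ℕ.<-irrefl refl) (⊥-elim ∘ ℕ.<-irrefl refl)
  iso 1F 1F = mk⇔ (⊥-elim ∘ ℕ.<-irrefl refl) (⊥-elim ∘ ℕ.<-irrefl refl)
  iso 2F 2F = mk⇔ (⊥-elim ∘ ℕ.<-irrefl refl) (⊥-elim ∘ ℕ.<-irrefl refl)
  iso 1F 0F = mk⇔ (λ _ → πb<πa) (λ _ → s≤s (s≤s z≤n))
  iso 2F 0F = mk⇔ (λ _ → ℕ.<-trans πc<πb πb<πa) (λ _ → s≤s z≤n)
  iso 2F 1F = mk⇔ (λ _ → πc<πb) (λ _ → s≤s z≤n)
  iso 0F 1F = mk⇔ (λ { (s≤s ()) }) (⊥-elim ∘ ℕ.<-asym πb<πa)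
  iso 0F 2F = mk⇔ (λ ()) (⊥-elim ∘ ℕ.<-asym (ℕ.<-trans πc<πb πb<πa))
  iso 1F 2F = mk⇔ (λ ()) (⊥-elim ∘ ℕ.<-asym πc<πb)

avoids321⇒avoids : (π : Permutation′ n) → Avoids321 (π ⟨$⟩ʳ_) → Avoids pattern321 π
avoids321⇒avoids π av (pos , mono , iso) =
  av (mono {0F} {1F} (s≤s z≤n)) (mono {1F} {2F} (s≤s (s≤s z≤n)))
     (Equivalence.to (iso 1F 0F) (s≤s (s≤s z≤n))) (Equivalence.to (iso 2F 1F) (s≤s z≤n))

-- The ballot condition and the first step

descents≤ascents-∷ : ∀ (x y : Fin n) zs → x < y →
  descents (y ∷ zs) ≤ suc (ascents (y ∷ zs)) → descents (x ∷ y ∷ zs) ≤ ascents (x ∷ y ∷ zs)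
descents≤ascents-∷ x y zs x<y d≤1+a
  rewrite dec-true (x <? y) x<y | dec-false (y <? x) (ℕ.<-asym x<y) = d≤1+a

-- A descent in front uses up the slack of one, so only in that case must the rest be balanced
-- without it.
descents≤1+ascents-∷ : ∀ (x y : Fin n) zs →
  descents (y ∷ zs) ≤ suc (ascents (y ∷ zs)) → (y < x → descents (y ∷ zs) ≤ ascents (y ∷ zs)) →
  descents (x ∷ y ∷ zs) ≤ suc (ascents (x ∷ y ∷ zs))
descents≤1+ascents-∷ x y zs d≤1+a d≤a with x <? y | y <? x
... | yes x<y | _       = ℕ.m≤n⇒m≤1+n (descents≤ascents-∷ x y zs x<y d≤1+a)
... | no  x≮y | no  y≮x rewrite dec-false (x <? y) x≮y | dec-false (y <? x) y≮x = d≤1+a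
... | no  x≮y | yes y<x rewrite dec-false (x <? y) x≮y | dec-true (y <? x) y<x = s≤s (d≤a y<x)

-- Each descent, except possibly a leading one, is directly preceded by an ascent.
descents≤1+ascents : (f : Fin n → Fin m) → DescentsIsolated f → ∀ i →
  descents (take i (tabulate f)) ≤ suc (ascents (take i (tabulate f)))
descents≤ascents : (f : Fin (suc (suc n)) → Fin m) → DescentsIsolated f → f 0F < f 1F → ∀ i →
  descents (take i (tabulate f)) ≤ ascents (take i (tabulate f))
descents≤ascents-afterDescent : (f : Fin (suc (suc n)) → Fin m) → DescentsIsolated f → f 1F < f 0F → ∀ i →
  descents (take (suc i) (tabulate (f ∘ suc))) ≤ ascents (take (suc i) (tabulate (f ∘ suc)))

descents≤1+ascents               f iso zero          = z≤n
descents≤1+ascents {zero}        f iso (suc i)       = z≤n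
descents≤1+ascents {suc zero}    f iso (suc zero)    = z≤n
descents≤1+ascents {suc zero}    f iso (suc (suc i)) = z≤n
descents≤1+ascents {suc (suc n)} f iso (suc zero)    = z≤n
descents≤1+ascents {suc (suc n)} f iso (suc (suc i)) =
  descents≤1+ascents-∷ (f 0F) (f 1F) (take i (tabulate (λ a → f (suc (suc a)))))
    (descents≤1+ascents (f ∘ suc) (descentsIsolated-tail f iso) (suc i))
    (λ p → descents≤ascents-afterDescent f iso p i)

descents≤ascents-afterDescent {zero}  f iso p zero    = z≤n
descents≤ascents-afterDescent {zero}  f iso p (suc i) = z≤n
descents≤ascents-afterDescent {suc n} f iso p i       =
  descents≤ascents (f ∘ suc) (descentsIsolated-tail f iso)
    (iso {0F} {1F} {2F} (s≤s z≤n) (s≤s (s≤s z≤n)) p) (suc i)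

descents≤ascents f iso p zero = z≤n
descents≤ascents f iso p (suc zero) = z≤n
descents≤ascents f iso p (suc (suc i)) =
  descents≤ascents-∷ (f 0F) (f 1F) (take i (tabulate (λ a → f (suc (suc a))))) p
    (descents≤1+ascents (f ∘ suc) (descentsIsolated-tail f iso) (suc i))

ballot⇒ascent : (π : Permutation′ (suc (suc n))) → Ballot π → π ⟨$⟩ʳ 0F < π ⟨$⟩ʳ 1F
ballot⇒ascent π ballot with π ⟨$⟩ʳ 0F <? π ⟨$⟩ʳ 1F
... | yes p = p
-- The prefix of length two is then a single descent, and the ballot condition reads `1 ≤ 0`.
... | no ¬p = contradiction (subst₂ _≤_ one-descent no-ascent (ballot 2)) λ ()
  where
  one-descent : descents (take 2 (word π)) ≡ 1
  one-descent rewrite dec-true (π ⟨$⟩ʳ 1F <? π ⟨$⟩ʳ 0F) (≮∧≢⇒> π ¬p λ ()) = refl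

  no-ascent : ascents (take 2 (word π)) ≡ 0
  no-ascent rewrite dec-false (π ⟨$⟩ʳ 0F <? π ⟨$⟩ʳ 1F) ¬p = refl

ascent⇒ballot : (π : Permutation′ (suc (suc n))) → Avoids321 (π ⟨$⟩ʳ_) →
  π ⟨$⟩ʳ 0F < π ⟨$⟩ʳ 1F → Ballot π
ascent⇒ballot π av = descents≤ascents (π ⟨$⟩ʳ_) λ {a} {b} {c} a<b b<c πb<πa →
  ≮∧≢⇒> π (av a<b b<c πb<πa) (Fin.<⇒≢ b<c)

-- Prepending a letter

-- f is the one-line notation of a permutation whose pattern after the first
-- letter is g.
record _HasTail_ (f : Fin (suc n) → Fin (suc m)) (g : Fin n → Fin m) : Set where
  constructor hasTail
  field at-suc : ∀ i → f (suc i) ≡ punchIn (f zero) (g i)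

open _HasTail_

≤⇒≤punchIn : ∀ (j : Fin (suc n)) i → k ≤ toℕ i → k ≤ toℕ (punchIn j i)
≤⇒≤punchIn zero    i       k≤i = ℕ.m≤n⇒m≤1+n k≤i
≤⇒≤punchIn (suc j) zero    k≤i = k≤i
≤⇒≤punchIn {k = zero}  (suc j) (suc i) k≤i = z≤n
≤⇒≤punchIn {k = suc k} (suc j) (suc i) (s≤s k≤i) = s≤s (≤⇒≤punchIn j i k≤i)

punchIn-<⇒< : ∀ (j : Fin (suc n)) i → punchIn j i < j → i < j
punchIn-<⇒< j i p = ℕ.≰⇒> λ j≤i → ℕ.<⇒≱ p (≤⇒≤punchIn j i j≤i)

<⇒punchIn-< : ∀ (j : Fin (suc n)) i → i < j → punchIn j i < j
<⇒punchIn-< (suc j) zero    i<j       = s≤s z≤n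
<⇒punchIn-< (suc j) (suc i) (s≤s i<j) = s≤s (<⇒punchIn-< j i i<j)

module _ {f : Fin (suc n) → Fin (suc m)} {g : Fin n → Fin m} (f∷g : f HasTail g) where

  tail-<⇒< : ∀ {a b} → f (suc a) < f (suc b) → g a < g b
  tail-<⇒< {a} {b} p rewrite at-suc f∷g a | at-suc f∷g b =
    ℕ.≰⇒> λ q → ℕ.<⇒≱ p (punchIn-mono-≤ (f zero) (g b) (g a) q)

  <⇒tail-< : ∀ {a b} → g a < g b → f (suc a) < f (suc b)
  <⇒tail-< {a} {b} p rewrite at-suc f∷g a | at-suc f∷g b =
    ℕ.≰⇒> λ q → ℕ.<⇒≱ p (punchIn-cancel-≤ (f zero) (g b) (g a) q)

  tail-<head⇒< : ∀ {a} → f (suc a) < f zero → g a < f zero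
  tail-<head⇒< {a} p rewrite at-suc f∷g a = punchIn-<⇒< (f zero) (g a) p

  <⇒tail-<head : ∀ {a} → g a < f zero → f (suc a) < f zero
  <⇒tail-<head {a} p rewrite at-suc f∷g a = <⇒punchIn-< (f zero) (g a) p

  tail-avoids321 : Avoids321 f → Avoids321 g
  tail-avoids321 av a<b b<c p q = av (s≤s a<b) (s≤s b<c) (<⇒tail-< p) (<⇒tail-< q)

  -- An inversion of `g` whose larger letter is below `f zero` would complete a 321 in `f`, with the
  -- first letter as its 3.
  tail-noInversionBelow : Avoids321 f → NoInversionBelow (toℕ (f zero)) g
  tail-noInversionBelow av {a} {b} a<b p =
    ℕ.≮⇒≥ λ q → av {0F} {suc a} {suc b} (s≤s z≤n) (s≤s a<b) (<⇒tail-<head q) (<⇒tail-< p)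

  -- A 321 in `f` either starts at the first letter, and its other two letters come from an
  -- inversion of `g` below `f zero`, or it lies entirely in the tail.
  avoids321-∷ : Avoids321 g → NoInversionBelow (toℕ (f zero)) g → Avoids321 f
  avoids321-∷ av ni {0F} {suc b} {suc c} a<b (s≤s b<c) p q =
    ℕ.<⇒≱ (tail-<head⇒< p) (ni b<c (tail-<⇒< q))
  avoids321-∷ av ni {suc a} {suc b} {suc c} (s≤s a<b) (s≤s b<c) p q =
    av a<b b<c (tail-<⇒< p) (tail-<⇒< q)

-- The generating tree of 321-avoiding permutations

-- Letters are inserted from the last position to the first.  label n c is the
-- largest l ≤ n for which the letters below l appear in increasing order in
-- decode n c.
Code  : ℕ → Set
label : ∀ n → Code n → ℕ

childLabel : ∀ l → Fin (suc l) → ℕ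
childLabel l zero    = suc l
childLabel l (suc j) = toℕ (suc j)

Code zero    = ⊤
Code (suc n) = Σ (Code n) (Fin ∘ suc ∘ label n)

label zero    _       = 0
label (suc n) (c , j) = childLabel (label n c) j

label≤n : ∀ n c → label n c ≤ n
label≤n zero    _           = z≤n
label≤n (suc n) (c , zero)  = s≤s (label≤n n c)
label≤n (suc n) (c , suc j) = ℕ.m≤n⇒m≤1+n (ℕ.≤-trans (toℕ<n j) (label≤n n c))

abstract

  -- Everything below uses only the first letter and the tail pattern of the result, not how
  -- `insert` builds it.
  prepend : Fin (suc n) → Permutation′ n → Permutation′ (suc n)
  prepend = insert zero

  prepend-head : ∀ (i : Fin (suc n)) π → prepend i π ⟨$⟩ʳ zero ≡ i
  prepend-head i π = refl

  prepend-tail : ∀ (i : Fin (suc n)) π → (prepend i π ⟨$⟩ʳ_) HasTail (π ⟨$⟩ʳ_)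
  prepend-tail i π = hasTail (insert-punchIn zero i π)

decode : ∀ n → Code n → Permutation′ n
decode zero    _       = id
decode (suc n) (c , j) = prepend (inject≤ j (s≤s (label≤n n c))) (decode n c)

decode-head : ∀ n c j → toℕ (decode (suc n) (c , j) ⟨$⟩ʳ zero) ≡ toℕ j
decode-head n c j = trans (cong toℕ (prepend-head _ _)) (toℕ-inject≤ j (s≤s (label≤n n c)))

decode-tail : ∀ n c j → (decode (suc n) (c , j) ⟨$⟩ʳ_) HasTail (decode n c ⟨$⟩ʳ_)
decode-tail n c j = prepend-tail _ _

decode-tail-zero : ∀ n c i → decode (suc n) (c , zero) ⟨$⟩ʳ suc i ≡ suc (decode n c ⟨$⟩ʳ i)
decode-tail-zero n c i =
  trans (at-suc (decode-tail n c zero) i) (cong (λ x → punchIn x (decode n c ⟨$⟩ʳ i)) (prepend-head _ _))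

remove-tail : (π : Permutation′ (suc n)) → (π ⟨$⟩ʳ_) HasTail (remove zero π ⟨$⟩ʳ_)
remove-tail π = hasTail (punchIn-permute π zero)

-- A first letter 0 starts no inversion, and the shift by one raises the bound together with the
-- label. A first letter `suc j` meets the bound itself; later inversions had a larger letter of at
-- least `label n c`, hence of at least `suc j`, and `punchIn` never lowers a letter.
decode-noInversionBelow : ∀ n c → NoInversionBelow (label n c) (decode n c ⟨$⟩ʳ_)
decode-noInversionBelow (suc n) (c , zero) {zero} {b} a<b p =
  contradiction (ℕ.<-≤-trans p (ℕ.≤-reflexive (decode-head n c zero))) λ ()
decode-noInversionBelow (suc n) (c , zero) {suc a} {suc b} (s≤s a<b) p =
  subst (λ x → suc (label n c) ≤ toℕ x) (sym (decode-tail-zero n c a))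
    (s≤s (decode-noInversionBelow n c a<b (tail-<⇒< (decode-tail n c zero) p)))
decode-noInversionBelow (suc n) (c , suc j) {zero} {b} a<b p =
  ℕ.≤-reflexive (sym (decode-head n c (suc j)))
decode-noInversionBelow (suc n) (c , suc j) {suc a} {suc b} (s≤s a<b) p =
  subst (λ x → suc (toℕ j) ≤ toℕ x) (sym (at-suc (decode-tail n c (suc j)) a))
    (≤⇒≤punchIn _ _ (ℕ.≤-trans (toℕ<n j)
      (decode-noInversionBelow n c a<b (tail-<⇒< (decode-tail n c (suc j)) p))))

-- Maximality of the label. The cap `k ≤ n` matters for the increasing word, where no inversion
-- bounds `k`.
noInversionBelow⇒≤label : ∀ n c → k ≤ n → NoInversionBelow k (decode n c ⟨$⟩ʳ_) → k ≤ label n c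
noInversionBelow⇒≤label zero    _          k≤n ni = k≤n
noInversionBelow⇒≤label {zero}  (suc n) (c , zero) k≤n ni = z≤n
noInversionBelow⇒≤label {suc k} (suc n) (c , zero) (s≤s k≤n) ni =
  s≤s (noInversionBelow⇒≤label n c k≤n λ {a} a<b p →
    ℕ.s≤s⁻¹ (subst (λ x → suc k ≤ toℕ x) (decode-tail-zero n c a)
      (ni (s≤s a<b) (<⇒tail-< (decode-tail n c zero) p))))
noInversionBelow⇒≤label {k} (suc n) (c , suc j) k≤n ni =
  -- The witness is the position of the letter `j`: the first letter is `suc j`, so `j` comes later
  -- and the two form an inversion with larger letter `suc j`.
  subst (k ≤_) (decode-head n c (suc j)) (ni 0<pos pos-inversion)
  where
  π   = decode (suc n) (c , suc j)
  j≤n = ℕ.m≤n⇒m≤1+n (label≤n n c)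
  pos = π ⟨$⟩ˡ inject≤ j j≤n

  π-pos : toℕ (π ⟨$⟩ʳ pos) ≡ toℕ j
  π-pos = trans (cong toℕ (inverseʳ π)) (toℕ-inject≤ j j≤n)

  pos-inversion : π ⟨$⟩ʳ pos < π ⟨$⟩ʳ zero
  pos-inversion = subst₂ ℕ._<_ (sym π-pos) (sym (decode-head n c (suc j))) (ℕ.n<1+n (toℕ j))

  0<pos : zero {n} < pos
  0<pos = Fin.≤∧≢⇒< z≤n λ 0≡pos →
    ℕ.<-irrefl (cong (toℕ ∘ (π ⟨$⟩ʳ_)) (sym 0≡pos)) pos-inversion

decode-avoids321 : ∀ n c → Avoids321 (decode n c ⟨$⟩ʳ_)
decode-avoids321 (suc n) (c , j) =
  avoids321-∷ (decode-tail n c j) (decode-avoids321 n c) λ a<b p →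
    ℕ.≤-trans (ℕ.≤-reflexive (decode-head n c j))
      (ℕ.≤-trans (ℕ.s≤s⁻¹ (toℕ<n j)) (decode-noInversionBelow n c a<b p))

decode-injective : ∀ n {c c′} → decode n c ≈ decode n c′ → c ≡ c′
-- The types of `j` and `j′` depend on `c` and `c′`, so before `c ≡ c′` is matched the two can be
-- compared only as numbers.
decode-cancel : ∀ n {c c′ j j′} → decode (suc n) (c , j) ≈ decode (suc n) (c′ , j′) →
  c ≡ c′ × toℕ j ≡ toℕ j′

decode-injective zero    _ = refl
decode-injective (suc n) {c , j} {c′ , j′} eq with decode-cancel n eq
... | refl , j≡j′ = cong (c ,_) (toℕ-injective j≡j′)

decode-cancel n {c} {c′} {j} {j′} eq =
    decode-injective n (λ i → punchIn-injective _ _ _ (begin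
      punchIn (π  ⟨$⟩ʳ zero) (decode n c  ⟨$⟩ʳ i)  ≡⟨ at-suc (decode-tail n c j) i ⟨
      π  ⟨$⟩ʳ suc i                                ≡⟨ eq (suc i) ⟩
      π′ ⟨$⟩ʳ suc i                                ≡⟨ at-suc (decode-tail n c′ j′) i ⟩
      punchIn (π′ ⟨$⟩ʳ zero) (decode n c′ ⟨$⟩ʳ i)  ≡⟨ cong (λ x → punchIn x _) (eq zero) ⟨
      punchIn (π  ⟨$⟩ʳ zero) (decode n c′ ⟨$⟩ʳ i)  ∎))
  , (begin
      toℕ j                ≡⟨ decode-head n c j ⟨
      toℕ (π  ⟨$⟩ʳ zero)   ≡⟨ cong toℕ (eq zero) ⟩
      toℕ (π′ ⟨$⟩ʳ zero)   ≡⟨ decode-head n c′ j′ ⟩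
      toℕ j′               ∎)
  where
  open ≡-Reasoning
  π  = decode (suc n) (c , j)
  π′ = decode (suc n) (c′ , j′)

-- Induction by removing the first letter. That letter is a legal choice at the code of the rest
-- because the label is maximal.
decode-surjective : ∀ n (π : Permutation′ n) → Avoids321 (π ⟨$⟩ʳ_) → ∃[ c ] decode n c ≈ π
decode-surjective zero    π av = tt , λ ()
decode-surjective (suc n) π av = (c , j) , eq
  where
  rec = decode-surjective n (remove zero π) (tail-avoids321 (remove-tail π) av)
  c   = proj₁ rec

  π₀≤label : toℕ (π ⟨$⟩ʳ zero) ≤ label n c
  π₀≤label = noInversionBelow⇒≤label n c (ℕ.s≤s⁻¹ (toℕ<n (π ⟨$⟩ʳ zero))) ni
    where
    ni : NoInversionBelow (toℕ (π ⟨$⟩ʳ zero)) (decode n c ⟨$⟩ʳ_)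
    ni = noInversionBelow-resp (sym ∘ proj₂ rec) (tail-noInversionBelow (remove-tail π) av)

  j = fromℕ< (s≤s π₀≤label)

  eq-head : decode (suc n) (c , j) ⟨$⟩ʳ zero ≡ π ⟨$⟩ʳ zero
  eq-head = toℕ-injective (trans (decode-head n c j) (toℕ-fromℕ< (s≤s π₀≤label)))

  eq : decode (suc n) (c , j) ≈ π
  eq zero    = eq-head
  eq (suc i) = trans (at-suc (decode-tail n c j) i)
    (trans (cong₂ punchIn eq-head (proj₂ rec i)) (sym (at-suc (remove-tail π) i)))

-- Codes of 321-avoiding ballot permutations

-- Here `i` is inserted next to last and `j` last; the type of `j` imposes `j ≤ i`, the condition
-- for an initial ascent.
BallotCode : ℕ → Set
BallotCode n = Σ[ c ∈ Code n ] Σ[ i ∈ Fin (suc (label n c)) ] Fin (suc (toℕ i))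

-- Ensures that every `j ≤ i` is a legal last insertion.
≤childLabel : ∀ l i → toℕ i ≤ childLabel l i
≤childLabel l zero    = z≤n
≤childLabel l (suc i) = ℕ.≤-refl

decodeBallot : ∀ n → BallotCode n → Permutation′ (suc (suc n))
decodeBallot n (c , i , j) =
  decode (suc (suc n)) ((c , i) , inject≤ j (s≤s (≤childLabel (label n c) i)))

-- Inserting `j` shifts up all letters from `j` on, so with `j ≤ i` the second letter becomes
-- `i + 1`, which exceeds `j`.
decodeBallot-ascent : ∀ n b → decodeBallot n b ⟨$⟩ʳ 0F < decodeBallot n b ⟨$⟩ʳ 1F
decodeBallot-ascent n (c , i , j) =
  ≮∧≢⇒> π {1F} {0F} (λ p → ℕ.<⇒≱ (tail-<head⇒< (decode-tail (suc n) (c , i) j′) p) π₀≤) λ ()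
  where
  π  = decodeBallot n (c , i , j)
  j′ = inject≤ j (s≤s (≤childLabel (label n c) i))

  open ℕ.≤-Reasoning
  π₀≤ : toℕ (π ⟨$⟩ʳ 0F) ≤ toℕ (decode (suc n) (c , i) ⟨$⟩ʳ zero)
  π₀≤ = begin
    toℕ (π ⟨$⟩ʳ 0F)                         ≡⟨ decode-head (suc n) (c , i) j′ ⟩
    toℕ j′                                  ≡⟨ toℕ-inject≤ j _ ⟩
    toℕ j                                   ≤⟨ ℕ.s≤s⁻¹ (toℕ<n j) ⟩
    toℕ i                                   ≡⟨ decode-head n c i ⟨
    toℕ (decode (suc n) (c , i) ⟨$⟩ʳ zero)  ∎

decodeBallot-injective : ∀ n {b b′} → decodeBallot n b ≈ decodeBallot n b′ → b ≡ b′
decodeBallot-injective n {c , i , j} {c′ , i′ , j′} eq with decode-cancel (suc n) eq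
... | refl , j≡j′ = cong (λ j → c , i , j) (toℕ-injective
  (trans (sym (toℕ-inject≤ j _)) (trans j≡j′ (toℕ-inject≤ j′ _))))

decodeBallot-surjective : ∀ n (π : Permutation′ (suc (suc n))) → Avoids321 (π ⟨$⟩ʳ_) →
  π ⟨$⟩ʳ 0F < π ⟨$⟩ʳ 1F → ∃[ b ] decodeBallot n b ≈ π
decodeBallot-surjective n π av π₀<π₁ = fromCode (decode-surjective (suc (suc n)) π av)
  where
  fromCode : ∃[ c ] decode (suc (suc n)) c ≈ π → ∃[ b ] decodeBallot n b ≈ π
  fromCode (((c , i) , j) , eq) = (c , i , fromℕ< (s≤s j≤i)) , λ a →
    trans (cong (λ x → decode (suc (suc n)) ((c , i) , x) ⟨$⟩ʳ a) j≡) (eq a)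
    where
    ρ = decode (suc (suc n)) ((c , i) , j)

    ρ₀<ρ₁ : ρ ⟨$⟩ʳ 0F < ρ ⟨$⟩ʳ 1F
    ρ₀<ρ₁ = subst₂ _<_ (sym (eq 0F)) (sym (eq 1F)) π₀<π₁

    open ℕ.≤-Reasoning
    j≤i : toℕ j ≤ toℕ i
    j≤i = begin
      toℕ j                                   ≡⟨ decode-head (suc n) (c , i) j ⟨
      -- If `i` were below `j`, it would escape the shift and remain below the first letter,
      -- contradicting the ascent.
      toℕ (ρ ⟨$⟩ʳ 0F)                         ≤⟨ ℕ.≮⇒≥ (λ p → ℕ.<-asym ρ₀<ρ₁ (<⇒tail-<head (decode-tail (suc n) (c , i) j) p)) ⟩
      toℕ (decode (suc n) (c , i) ⟨$⟩ʳ zero)  ≡⟨ decode-head n c i ⟩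
      toℕ i                                   ∎

    j≡ : inject≤ (fromℕ< (s≤s j≤i)) (s≤s (≤childLabel (label n c) i)) ≡ j
    j≡ = toℕ-injective (trans (toℕ-inject≤ (fromℕ< (s≤s j≤i)) _) (toℕ-fromℕ< (s≤s j≤i)))

𝓑-inverse : ∀ n → Inverse (𝓑 (suc (suc n)) pattern321) (setoid (BallotCode n))
𝓑-inverse n = record
  { to        = proj₁ ∘ encode
  ; from      = λ b → decodeBallot n b ,
      ascent⇒ballot (decodeBallot n b) (decode-avoids321 _ _) (decodeBallot-ascent n b) ,
      avoids321⇒avoids (decodeBallot n b) (decode-avoids321 _ _)
  ; to-cong   = λ {x} {y} x≈y → decodeBallot-injective n λ i →
      trans (proj₂ (encode x) i) (trans (x≈y i) (sym (proj₂ (encode y) i)))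
  ; from-cong = λ { refl _ → refl }
  ; inverse   = (λ {_} {y} y≈b → decodeBallot-injective n λ i → trans (proj₂ (encode y) i) (y≈b i))
              , λ { {x} refl → proj₂ (encode x) }
  }
  where
  encode : (p : Setoid.Carrier (𝓑 (suc (suc n)) pattern321)) → ∃[ b ] decodeBallot n b ≈ proj₁ p
  encode (π , ballot , av) =
    decodeBallot-surjective n π (avoids⇒avoids321 π av) (ballot⇒ascent π ballot)

module Counting where

  open import Data.Nat.Base using (_+_; _*_; _∸_)
  open import Data.Nat.Combinatorics
    using (_C_; nCk≡nC[n∸k]; nCk+nC[k+1]≡[n+1]C[k+1]; nC1≡n; nCn≡1)
  open import Data.Nat.Properties
    using (+-0-commutativeMonoid; +-assoc; +-comm; +-identityʳ; +-suc; +-cancelʳ-≡;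
           *-comm; *-identityˡ; *-identityʳ; *-zeroʳ; *-distribˡ-+; *-distribʳ-+;
           m+n∸n≡m; m≤n+m; suc-injective)
  open import Data.Nat.Tactic.RingSolver using (solve-∀)
  open import Algebra.Properties.CommutativeMonoid.Sum +-0-commutativeMonoid
    using (sum; sum-init-last; ∑-distrib-+; sum-cong-≗)
  open import Algebra.Properties.Group using (x≈z//y)
  import Data.Integer.Base as ℤ
  import Data.Integer.Properties as ℤ
  import Data.Rational.Base as ℚ
  import Data.Rational.Properties as ℚ
  open import Data.Rational.Unnormalised.Base as ℚᵘ using (mkℚᵘ; *≡*)
  import Data.Rational.Unnormalised.Properties as ℚᵘ

  -- Summation over the generating tree

  Σ-Fin-suc↔⊎ : {B : Fin (suc n) → Set} → Σ (Fin (suc n)) B ↔ (B zero ⊎ Σ (Fin n) (B ∘ suc))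
  Σ-Fin-suc↔⊎ = mk↔ₛ′
    (λ { (zero , b) → inj₁ b ; (suc i , b) → inj₂ (i , b) })
    [ zero ,_ , (λ (i , b) → suc i , b) ]′
    (λ { (inj₁ _) → refl ; (inj₂ _) → refl })
    (λ { (zero , _) → refl ; (suc _ , _) → refl })

  Σ-Fin↔Fin-sum : ∀ n (g : Fin n → ℕ) → Σ (Fin n) (Fin ∘ g) ↔ Fin (sum g)
  Σ-Fin↔Fin-sum zero    g = mk↔ₛ′ (λ ()) (λ ()) (λ ()) (λ ())
  Σ-Fin↔Fin-sum (suc n) g =
    ↔-sym +↔⊎ ↔-∘ ((↔-id _ ⊎-↔ Σ-Fin↔Fin-sum n (g ∘ suc)) ↔-∘ Σ-Fin-suc↔⊎)

  sumOverChildren : (ℕ → ℕ) → ℕ → ℕ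
  sumOverChildren f l = sum (f ∘ childLabel l)

  -- Equals the sum of `f (label n c)` over all `c : Code n`: summing out the last insertion leaves
  -- a function of the label one generation earlier.
  sumOverCodes : ℕ → (ℕ → ℕ) → ℕ
  sumOverCodes zero    f = f 0
  sumOverCodes (suc n) f = sumOverCodes n (sumOverChildren f)

  Σ-Code↔ : ∀ n (f : ℕ → ℕ) → Σ (Code n) (Fin ∘ f ∘ label n) ↔ Fin (sumOverCodes n f)
  Σ-Code↔ zero    f = mk↔ₛ′ proj₂ (tt ,_) (λ _ → refl) (λ _ → refl)
  Σ-Code↔ (suc n) f = Σ-Code↔ n (sumOverChildren f)
    ↔-∘ (congˡ (λ {c} → Σ-Fin↔Fin-sum _ (f ∘ childLabel (label n c))) ↔-∘ Σ-assoc)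

  sumOverCodes-cong : ∀ n {f g} → f ≗ g → sumOverCodes n f ≡ sumOverCodes n g
  sumOverCodes-cong zero    f≗g = f≗g 0
  sumOverCodes-cong (suc n) f≗g = sumOverCodes-cong n λ l →
    sum-cong-≗ (f≗g ∘ childLabel l)

  sumOverCodes-+ : ∀ n f g → sumOverCodes n (λ l → f l + g l) ≡ sumOverCodes n f + sumOverCodes n g
  sumOverCodes-+ zero    f g = refl
  sumOverCodes-+ (suc n) f g = trans
    (sumOverCodes-cong n λ l → ∑-distrib-+ (f ∘ childLabel l) (g ∘ childLabel l))
    (sumOverCodes-+ n (sumOverChildren f) (sumOverChildren g))

  sum-toℕ-suc : ∀ (f : ℕ → ℕ) m → sum {suc m} (f ∘ toℕ) ≡ sum {m} (f ∘ toℕ) + f m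
  sum-toℕ-suc f m = trans (sum-init-last {m} (f ∘ toℕ))
    (cong₂ _+_ (sum-cong-≗ {m} (cong f ∘ toℕ-inject₁)) (cong f (toℕ-fromℕ m)))

  -- The children of a node labelled `l` have the labels 1, ..., `l + 1`, so raising `l` by one adds
  -- a single child, labelled `l + 2`.
  sumOverChildren-suc : ∀ f l → sumOverChildren f (suc l) ≡ sumOverChildren f l + f (suc (suc l))
  sumOverChildren-suc f l = begin
    f (2 + l) + sum {suc l} (f ∘ suc ∘ toℕ)            ≡⟨ cong (f (2 + l) +_) (sum-toℕ-suc (f ∘ suc) l) ⟩
    f (2 + l) + (sum {l} (f ∘ suc ∘ toℕ) + f (suc l))  ≡⟨ rearrange (f (2 + l)) (sum {l} (f ∘ suc ∘ toℕ)) (f (suc l)) ⟩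
    f (suc l) + sum {l} (f ∘ suc ∘ toℕ) + f (2 + l)    ∎
    where
    open ≡-Reasoning
    rearrange : ∀ a b c → a + (b + c) ≡ c + b + a
    rearrange = solve-∀

  -- Counting descendants

  -- Counts the ways to make `k` further insertions from a code with label `l`; at `l = 0` these are
  -- the Catalan numbers.
  descendants : ℕ → ℕ → ℕ
  descendants zero    _ = 1
  descendants (suc k)   = sumOverChildren (descendants k)

  -- The nodes `k` generations below generation `n` are those of generation `n + k` below the root.
  sumOverCodes-descendants : ∀ n k → sumOverCodes n (descendants k) ≡ descendants (n + k) 0
  sumOverCodes-descendants zero    k = refl
  sumOverCodes-descendants (suc n) k =
    trans (sumOverCodes-descendants n (suc k)) (cong (λ x → descendants x 0) (+-suc n k))

  descendants-1 : ∀ l → descendants 1 l ≡ suc l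
  descendants-1 zero    = refl
  descendants-1 (suc l) = trans (sumOverChildren-suc (λ _ → 1) l)
    (trans (+-comm (descendants 1 l) 1) (cong suc (descendants-1 l)))

  -- The number of pairs j ≤ i ≤ l, where i is inserted next to last and j last.
  ballotPairs : ℕ → ℕ
  ballotPairs l = sum {suc l} (suc ∘ toℕ)

  -- Among all pairs of two successive insertions, those with `j > i` have `i = 0` and
  -- `1 ≤ j ≤ l + 1`, since for `i > 0` the child label is `i` itself. There are `l + 1` of them, as
  -- many as children.
  ballotPairs+descendants : ∀ l → ballotPairs l + descendants 1 l ≡ descendants 2 l
  ballotPairs+descendants zero    = refl
  ballotPairs+descendants (suc l) = begin
    ballotPairs (suc l) + descendants 1 (suc l)
      ≡⟨ cong₂ _+_ (sum-toℕ-suc suc (suc l)) (sumOverChildren-suc (λ _ → 1) l) ⟩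
    ballotPairs l + (2 + l) + (descendants 1 l + 1)
      ≡⟨ rearrange (ballotPairs l) (2 + l) (descendants 1 l) ⟩
    ballotPairs l + descendants 1 l + (3 + l)
      ≡⟨ cong₂ _+_ (ballotPairs+descendants l) (sym (descendants-1 (2 + l))) ⟩
    descendants 2 l + descendants 1 (2 + l)
      ≡⟨ sumOverChildren-suc (descendants 1) l ⟨
    descendants 2 (suc l)  ∎
    where
    open ≡-Reasoning
    rearrange : ∀ a b c → a + b + (c + 1) ≡ a + c + (1 + b)
    rearrange = solve-∀

  ballotCount : ℕ → ℕ
  ballotCount n = sumOverCodes n ballotPairs

  ballotCount+descendants : ∀ n → ballotCount n + descendants (suc n) 0 ≡ descendants (suc (suc n)) 0
  ballotCount+descendants n = begin
    ballotCount n + descendants (suc n) 0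
      ≡⟨ cong (λ k → ballotCount n + descendants k 0) (+-comm n 1) ⟨
    ballotCount n + descendants (n + 1) 0
      ≡⟨ cong (ballotCount n +_) (sumOverCodes-descendants n 1) ⟨
    ballotCount n + sumOverCodes n (descendants 1)
      ≡⟨ sumOverCodes-+ n ballotPairs (descendants 1) ⟨
    sumOverCodes n (λ l → ballotPairs l + descendants 1 l)
      ≡⟨ sumOverCodes-cong n ballotPairs+descendants ⟩
    sumOverCodes n (descendants 2)
      ≡⟨ sumOverCodes-descendants n 2 ⟩
    descendants (n + 2) 0
      ≡⟨ cong (λ k → descendants k 0) (+-comm n 2) ⟩
    descendants (suc (suc n)) 0  ∎
    where open ≡-Reasoning

  -- The only child of the root has label 1, and its children have labels 1 and 2. The child
  -- labelled 1 accounts for `descendants (suc n) 0`, which leaves the subtree at label 2.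
  ballotCount≡descendants : ∀ n → ballotCount n ≡ descendants n 2
  ballotCount≡descendants n = +-cancelʳ-≡ (descendants (suc n) 0) _ _ (begin
    ballotCount n + descendants (suc n) 0    ≡⟨ ballotCount+descendants n ⟩
    descendants (suc n) 1 + 0                ≡⟨ +-identityʳ _ ⟩
    descendants (suc n) 1                    ≡⟨ sumOverChildren-suc (descendants n) 0 ⟩
    descendants (suc n) 0 + descendants n 2  ≡⟨ +-comm (descendants (suc n) 0) _ ⟩
    descendants n 2 + descendants (suc n) 0  ∎)
    where open ≡-Reasoning

  -- Closed form of the ballot numbers

  infixl 6.5 _C⁻_

  -- The binomial coefficient with lower index `k - 1`, set to 0 at `k = 0`, where truncated
  -- subtraction would give 1.
  _C⁻_ : ℕ → ℕ → ℕ
  n C⁻ zero  = 0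
  n C⁻ suc k = n C k

  nC0≡1 : ∀ n → n C 0 ≡ 1
  nC0≡1 n = trans (nCk≡nC[n∸k] {k = 0} {n = n} z≤n) (nCn≡1 n)

  pascal : ∀ n k → n C⁻ k + n C k ≡ suc n C k
  pascal n zero    = trans (nC0≡1 n) (sym (nC0≡1 (suc n)))
  pascal n (suc k) = nCk+nC[k+1]≡[n+1]C[k+1] n k

  [1+2k]Ck≡[1+2k]C[1+k] : ∀ k → (k + suc k) C k ≡ (k + suc k) C suc k
  [1+2k]Ck≡[1+2k]C[1+k] k =
    sym (trans (nCk≡nC[n∸k] (m≤n+m (suc k) k)) (cong ((k + suc k) C_) (m+n∸n≡m k (suc k))))

  -- The ballot numbers, by the reflection formula.
  descendants+C⁻ : ∀ k l N → k + (k + l) ≡ N → descendants k l + N C⁻ k ≡ N C k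
  descendants+C⁻ zero    l       N _    = sym (nC0≡1 N)
  descendants+C⁻ (suc k) zero    (suc N) eq = begin
    descendants k 1 + 0 + suc N C k         ≡⟨ cong₂ _+_ (+-identityʳ (descendants k 1)) (sym (pascal N k)) ⟩
    descendants k 1 + (N C⁻ k + N C k)      ≡⟨ +-assoc (descendants k 1) _ _ ⟨
    descendants k 1 + N C⁻ k + N C k        ≡⟨ cong (_+ N C k) (descendants+C⁻ k 1 N k+[k+1]≡N) ⟩
    -- Here `N = 2k + 1` is odd, so its two middle binomial coefficients agree.
    N C k + N C k                           ≡⟨ cong (λ M → N C k + M) NCk≡NC[1+k] ⟩
    N C k + N C suc k                       ≡⟨ pascal N (suc k) ⟩
    suc N C suc k                           ∎
    where
    open ≡-Reasoning
    k+1+k≡N : k + suc k ≡ N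
    k+1+k≡N = trans (cong (λ x → k + suc x) (sym (+-identityʳ k))) (suc-injective eq)

    k+[k+1]≡N : k + (k + 1) ≡ N
    k+[k+1]≡N = trans (cong (k +_) (+-comm k 1)) k+1+k≡N

    NCk≡NC[1+k] : N C k ≡ N C suc k
    NCk≡NC[1+k] = subst (λ M → M C k ≡ M C suc k) k+1+k≡N ([1+2k]Ck≡[1+2k]C[1+k] k)
  descendants+C⁻ (suc k) (suc l) (suc N) eq = begin
    descendants (suc k) (suc l) + suc N C k
      ≡⟨ cong₂ _+_ (sumOverChildren-suc (descendants k) l) (sym (pascal N k)) ⟩
    descendants (suc k) l + descendants k (2 + l) + (N C⁻ k + N C k)
      ≡⟨ rearrange (descendants (suc k) l) (descendants k (2 + l)) (N C⁻ k) (N C k) ⟩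
    descendants k (2 + l) + N C⁻ k + (descendants (suc k) l + N C k)
      ≡⟨ cong₂ _+_ (descendants+C⁻ k (2 + l) N (trans (shift₂ k l) N≡))
                   (descendants+C⁻ (suc k) l N (trans (shift₁ k l) N≡)) ⟩
    N C k + N C suc k
      ≡⟨ pascal N (suc k) ⟩
    suc N C suc k  ∎
    where
    open ≡-Reasoning
    N≡ = suc-injective eq

    rearrange : ∀ a b c d → a + b + (c + d) ≡ b + c + (a + d)
    rearrange = solve-∀

    shift₁ : ∀ k l → suc k + (suc k + l) ≡ k + (suc k + suc l)
    shift₁ = solve-∀

    shift₂ : ∀ k l → k + (k + (2 + l)) ≡ k + (suc k + suc l)
    shift₂ = solve-∀

  -- The absorption identity `(k+1) C(n,k+1) = (n-k) C(n,k)` with the subtraction moved to the left;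
  -- by induction through Pascal's rule.
  [1+k]*nC[1+k]+k*nCk≡n*nCk : ∀ n k → suc k * (n C suc k) + k * (n C k) ≡ n * (n C k)
  [1+k]*nC[1+k]+k*nCk≡n*nCk zero    zero    = refl
  [1+k]*nC[1+k]+k*nCk≡n*nCk zero    (suc k) = cong₂ _+_ (*-zeroʳ (suc (suc k))) (*-zeroʳ (suc k))
  [1+k]*nC[1+k]+k*nCk≡n*nCk (suc n) zero    = begin
    1 * (suc n C 1) + 0  ≡⟨ +-identityʳ (1 * (suc n C 1)) ⟩
    1 * (suc n C 1)      ≡⟨ *-identityˡ (suc n C 1) ⟩
    suc n C 1            ≡⟨ nC1≡n (suc n) ⟩
    suc n                ≡⟨ *-identityʳ (suc n) ⟨
    suc n * 1            ≡⟨ cong (suc n *_) (nC0≡1 (suc n)) ⟨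
    suc n * (suc n C 0)  ∎
    where open ≡-Reasoning
  [1+k]*nC[1+k]+k*nCk≡n*nCk (suc n) (suc k) = begin
    suc (suc k) * (suc n C suc (suc k)) + suc k * (suc n C suc k)
      ≡⟨ cong₂ (λ x y → suc (suc k) * x + suc k * y) (sym (pascal n (suc (suc k)))) (sym (pascal n (suc k))) ⟩
    suc (suc k) * (b + c) + suc k * (a + b)
      ≡⟨ expand k a b c ⟩
    (suc (suc k) * c + suc k * b) + (suc k * b + k * a) + (a + b)
      ≡⟨ cong₂ (λ x y → x + y + (a + b)) ([1+k]*nC[1+k]+k*nCk≡n*nCk n (suc k)) ([1+k]*nC[1+k]+k*nCk≡n*nCk n k) ⟩
    n * b + n * a + (a + b)
      ≡⟨ collect n a b ⟩
    suc n * (a + b)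
      ≡⟨ cong (suc n *_) (pascal n (suc k)) ⟩
    suc n * (suc n C suc k)  ∎
    where
    open ≡-Reasoning
    a = n C k
    b = n C suc k
    c = n C suc (suc k)

    expand : ∀ k a b c → suc (suc k) * (b + c) + suc k * (a + b) ≡
      (suc (suc k) * c + suc k * b) + (suc k * b + k * a) + (a + b)
    expand = solve-∀

    collect : ∀ n a b → n * b + n * a + (a + b) ≡ suc n * (a + b)
    collect = solve-∀

  -- The ratio of neighbouring binomial coefficients, which lets the subtracted term of the
  -- reflection formula be merged with the other.
  [1+r]*[k+r]C⁻k≡k*[k+r]Ck : ∀ k r → suc r * ((k + r) C⁻ k) ≡ k * ((k + r) C k)
  [1+r]*[k+r]C⁻k≡k*[k+r]Ck zero    r = *-zeroʳ r
  [1+r]*[k+r]C⁻k≡k*[k+r]Ck (suc k) r = +-cancelʳ-≡ (k * (N C k)) _ _ (begin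
    suc r * (N C k) + k * (N C k)      ≡⟨ *-distribʳ-+ (N C k) (suc r) k ⟨
    (suc r + k) * (N C k)              ≡⟨ cong (λ x → suc x * (N C k)) (+-comm r k) ⟩
    N * (N C k)                        ≡⟨ [1+k]*nC[1+k]+k*nCk≡n*nCk N k ⟨
    suc k * (N C suc k) + k * (N C k)  ∎)
    where
    open ≡-Reasoning
    N = suc k + r

  -- After multiplication by `k + l + 1`, the subtracted term of the reflection formula becomes
  -- `k * (N C k)`, and `(k + l + 1) - k = l + 1` remains as the factor.
  descendants-closed : ∀ k l → suc (k + l) * descendants k l ≡ suc l * ((k + (k + l)) C k)
  descendants-closed k l = +-cancelʳ-≡ (k * (N C k)) _ _ (begin
    suc (k + l) * descendants k l + k * (N C k)
      ≡⟨ cong (suc (k + l) * descendants k l +_) ([1+r]*[k+r]C⁻k≡k*[k+r]Ck k (k + l)) ⟨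
    suc (k + l) * descendants k l + suc (k + l) * (N C⁻ k)
      ≡⟨ *-distribˡ-+ (suc (k + l)) (descendants k l) (N C⁻ k) ⟨
    suc (k + l) * (descendants k l + N C⁻ k)
      ≡⟨ cong (suc (k + l) *_) (descendants+C⁻ k l N refl) ⟩
    suc (k + l) * (N C k)
      ≡⟨ cong (λ x → suc x * (N C k)) (+-comm k l) ⟩
    (suc l + k) * (N C k)
      ≡⟨ *-distribʳ-+ (N C k) (suc l) k ⟩
    suc l * (N C k) + k * (N C k)  ∎)
    where
    open ≡-Reasoning
    N = k + (k + l)

  -- Passage to the rationals

  -- In the unnormalised rationals equality is cross-multiplication, so no reduction by a gcd
  -- intervenes.
  a/[1+d]*b≡c : ∀ a d b c → suc d * c ≡ a * b → (ℤ.+ a ℚ./ suc d) ℚ.* fromℕ b ≡ fromℕ c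
  a/[1+d]*b≡c a d b c eq = ℚ.toℚᵘ-injective (begin
    ℚ.toℚᵘ ((ℤ.+ a ℚ./ suc d) ℚ.* fromℕ b)
      ≈⟨ ℚ.toℚᵘ-homo-* (ℤ.+ a ℚ./ suc d) (fromℕ b) ⟩
    ℚ.toℚᵘ (ℤ.+ a ℚ./ suc d) ℚᵘ.* ℚ.toℚᵘ (fromℕ b)
      ≈⟨ ℚᵘ.*-cong (ℚ.toℚᵘ-fromℚᵘ (mkℚᵘ (ℤ.+ a) d)) (ℚ.toℚᵘ-fromℚᵘ (mkℚᵘ (ℤ.+ b) 0)) ⟩
    mkℚᵘ (ℤ.+ a) d ℚᵘ.* mkℚᵘ (ℤ.+ b) 0
      ≈⟨ *≡* cross ⟩
    mkℚᵘ (ℤ.+ c) 0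
      ≈⟨ ℚ.toℚᵘ-fromℚᵘ (mkℚᵘ (ℤ.+ c) 0) ⟨
    ℚ.toℚᵘ (fromℕ c)  ∎)
    where
    open ℚᵘ.≃-Reasoning
    cross : ℤ.+ a ℤ.* ℤ.+ b ℤ.* ℤ.+ 1 ≡ ℤ.+ c ℤ.* ℤ.+ (suc d * 1)
    cross = ≡.begin
      ℤ.+ a ℤ.* ℤ.+ b ℤ.* ℤ.+ 1   ≡.≡⟨ ℤ.*-identityʳ (ℤ.+ a ℤ.* ℤ.+ b) ⟩
      ℤ.+ a ℤ.* ℤ.+ b             ≡.≡⟨ ℤ.pos-* a b ⟨
      ℤ.+ (a * b)                 ≡.≡⟨ cong ℤ.+_ (sym eq) ⟩
      ℤ.+ (suc d * c)             ≡.≡⟨ cong ℤ.+_ (*-comm (suc d) c) ⟩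
      ℤ.+ (c * suc d)             ≡.≡⟨ cong (λ x → ℤ.+ (c * x)) (*-identityʳ (suc d)) ⟨
      ℤ.+ (c * (suc d * 1))       ≡.≡⟨ ℤ.pos-* c (suc d * 1) ⟩
      ℤ.+ c ℤ.* ℤ.+ (suc d * 1)   ≡.∎
      where module ≡ = ≡-Reasoning

  fromℕ-+ : ∀ a b → fromℕ (a + b) ≡ fromℕ a ℚ.+ fromℕ b
  fromℕ-+ a b = ℚ.toℚᵘ-injective (begin
    ℚ.toℚᵘ (fromℕ (a + b))
      ≈⟨ ℚ.toℚᵘ-fromℚᵘ (mkℚᵘ (ℤ.+ (a + b)) 0) ⟩
    mkℚᵘ (ℤ.+ (a + b)) 0
      ≈⟨ *≡* (cong (ℤ._* ℤ.+ 1) numerator) ⟩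
    mkℚᵘ (ℤ.+ a) 0 ℚᵘ.+ mkℚᵘ (ℤ.+ b) 0
      ≈⟨ ℚᵘ.+-cong (ℚ.toℚᵘ-fromℚᵘ (mkℚᵘ (ℤ.+ a) 0)) (ℚ.toℚᵘ-fromℚᵘ (mkℚᵘ (ℤ.+ b) 0)) ⟨
    ℚ.toℚᵘ (fromℕ a) ℚᵘ.+ ℚ.toℚᵘ (fromℕ b)
      ≈⟨ ℚ.toℚᵘ-homo-+ (fromℕ a) (fromℕ b) ⟨
    ℚ.toℚᵘ (fromℕ a ℚ.+ fromℕ b)  ∎)
    where
    open ℚᵘ.≃-Reasoning
    numerator : ℤ.+ (a + b) ≡ ℤ.+ a ℤ.* ℤ.+ 1 ℤ.+ ℤ.+ b ℤ.* ℤ.+ 1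
    numerator = trans (ℤ.pos-+ a b)
      (sym (cong₂ ℤ._+_ (ℤ.*-identityʳ (ℤ.+ a)) (ℤ.*-identityʳ (ℤ.+ b))))

  catalan≡descendants : ∀ n → catalan n ≡ fromℕ (descendants n 0)
  catalan≡descendants n = a/[1+d]*b≡c 1 n ((2 * n) C n) (descendants n 0)
    -- `2 * n` unfolds to `n + (n + 0)`, already the upper index of the closed form at `l = 0`; only
    -- the factor `suc (n + 0)` needs rewriting.
    (subst (λ l → suc l * descendants n 0 ≡ 1 * ((2 * n) C n)) (+-identityʳ n)
      (descendants-closed n 0))

  ballotCount≡catalan-difference : ∀ n → fromℕ (ballotCount n) ≡ catalan (suc (suc n)) ℚ.- catalan (suc n)
  ballotCount≡catalan-difference n = begin
    fromℕ (ballotCount n)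
      ≡⟨ x≈z//y ℚ.+-0-group _ _ _ (trans (sym (fromℕ-+ (ballotCount n) _)) (cong fromℕ (ballotCount+descendants n))) ⟩
    fromℕ (descendants (suc (suc n)) 0) ℚ.- fromℕ (descendants (suc n) 0)
      ≡⟨ cong₂ ℚ._-_ (catalan≡descendants (suc (suc n))) (catalan≡descendants (suc n)) ⟨
    catalan (suc (suc n)) ℚ.- catalan (suc n)  ∎
    where open ≡-Reasoning

  -- The closed form at label `l = 2`, whose factor `l + 1` is the 3.
  ballotCount-closed : ∀ n → (ℤ.+ 3 ℚ./ suc (suc (suc n))) ℚ.* binomial (2 * suc (suc n) ∸ 2) n ≡ fromℕ (ballotCount n)
  ballotCount-closed n = a/[1+d]*b≡c 3 (suc (suc n)) ((2 * suc (suc n) ∸ 2) C n) (ballotCount n) (begin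
    suc (suc (suc n)) * ballotCount n  ≡⟨ cong₂ _*_ (cong suc (+-comm 2 n)) (ballotCount≡descendants n) ⟩
    suc (n + 2) * descendants n 2      ≡⟨ descendants-closed n 2 ⟩
    -- `2 * suc (suc n) ∸ 2` computes to `n + suc (suc (n + 0))`.
    3 * ((n + (n + 2)) C n)            ≡⟨ cong (λ x → 3 * ((n + x) C n)) (reorder n) ⟩
    3 * ((2 * suc (suc n) ∸ 2) C n)    ∎)
    where
    open ≡-Reasoning
    reorder : ∀ n → n + 2 ≡ suc (suc (n + 0))
    reorder = solve-∀

  𝓑-cardinality : ∀ n → HasCardinality (𝓑 (suc (suc n)) pattern321) (ballotCount n)
  𝓑-cardinality n = inverse (𝓑-inverse n)
    (Σ-Code↔ n ballotPairs ↔-∘ congˡ (λ {c} → Σ-Fin↔Fin-sum (suc (label n c)) (suc ∘ toℕ)))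

open import Data.Integer.Base using (+_)
open import Data.Nat.Base using (ℕ; suc; _≤_; _∸_) renaming (_*_ to _*ℕ_)
open import Data.Product.Base using (∃-syntax; _×_)
open import Data.Rational.Base using (_/_; _*_; _-_)
open import Relation.Binary.PropositionalEquality using (_≡_)

theorem4p1 : ∀ (n : ℕ) → 2 ≤ n →
    ∃[ c ] (HasCardinality (𝓑 n pattern321) c
    × fromℕ c ≡ catalan n - catalan (n ∸ 1)
    × catalan n - catalan (n ∸ 1) ≡ (+ 3 / suc n) * binomial (2 *ℕ n ∸ 2) (n ∸ 2))
theorem4p1 (suc zero)    (s≤s ())
theorem4p1 (suc (suc n)) _ =
    ballotCount n
  , 𝓑-cardinality n
  , ballotCount≡catalan-difference n
  , trans (sym (ballotCount≡catalan-difference n)) (sym (ballotCount-closed n))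
  where open Counting
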